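{- Let $G$ be a finite simple graph with minimum degree $\delta \ge 3$ and a cut vertex $v$ such that $G - v$ has a connected component with girth at least $5$. Then $3\delta - 6 \le Z(G)$.
   Context: A cut vertex is a vertex whose removal increases the number of connected components. The girth of a graph is the length of a shortest cycle (infinite if acyclic). Zero forcing process: start with an initial set $S$ of colored vertices. A colored vertex $u$ forces an uncolored neighbor $w$ (making $w$ colored) if $w$ is the only uncolored neighbor of $u$; forces are applied repeatedly. $S$ is a zero forcing set if eventually every vertex becomes colored. $Z(G)$ is the minimum size of a zero forcing set. -}

module Defs where

open import Data.Nat using (ℕ; suc; _≤_; _<_)
open import Data.Bool using (Bool; true; false)
open import Data.Fin using (Fin; zero; suc; inject₁; fromℕ)
open import Data.Fin.Subset using (Subset; _∈_; ∣_∣)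
open import Data.Vec using (tabulate)
open import Data.Unit using (⊤)
open import Data.Product using (Σ; ∃; _×_; _,_)
open import Function.Definitions using (Injective)
open import Relation.Binary.PropositionalEquality using (_≡_; _≢_)

record Graph (n : ℕ) : Set where
  field
    adj    : Fin n → Fin n → Bool
    sym    : ∀ x y → adj x y ≡ adj y x
    irrefl : ∀ x → adj x x ≡ false
open Graph public

Adj : ∀ {n} → Graph n → Fin n → Fin n → Set
Adj G x y = adj G x y ≡ true

degree : ∀ {n} → Graph n → Fin n → ℕ
degree G v = ∣ tabulate (adj G v) ∣

IsMinDegree : ∀ {n} → Graph n → ℕ → Set
IsMinDegree G δ = (∀ v → δ ≤ degree G v) × ∃ λ v → degree G v ≡ δ

data Reach {n} (G : Graph n) (S : Fin n → Set) : Fin n → Fin n → Set where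
  here : ∀ {x} → S x → Reach G S x x
  step : ∀ {x y z} → S x → Adj G x y → Reach G S y z → Reach G S x z

-- The induced subgraph G[S] has exactly k connected components:
-- k representatives lying in pairwise different components, covering S.
NumComponents : ∀ {n} → Graph n → (Fin n → Set) → ℕ → Set
NumComponents {n} G S k =
  Σ (Fin k → Fin n) λ r →
    (∀ i → S (r i)) ×
    (∀ i j → Reach G S (r i) (r j) → i ≡ j) ×
    (∀ x → S x → ∃ λ i → Reach G S (r i) x)

AllV : ∀ {n} → Fin n → Set
AllV _ = ⊤

Minus : ∀ {n} → Fin n → Fin n → Set
Minus v x = x ≢ v

IsCutVertex : ∀ {n} → Graph n → Fin n → Set
IsCutVertex G v = Σ ℕ λ a → Σ ℕ λ b →
  NumComponents G AllV a × NumComponents G (Minus v) b × a < b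

-- A cycle of length (suc k) in the induced subgraph G[S]:
-- distinct vertices c 0, …, c k in S, consecutive ones adjacent, c k ~ c 0,
-- and length at least 3.
record Cycle {n} (G : Graph n) (S : Fin n → Set) (k : ℕ) : Set where
  field
    len≥3  : 3 ≤ suc k
    vtx    : Fin (suc k) → Fin n
    inj    : Injective _≡_ _≡_ vtx
    inS    : ∀ i → S (vtx i)
    edge   : ∀ (i : Fin k) → Adj G (vtx (inject₁ i)) (vtx (suc i))
    close  : Adj G (vtx (fromℕ k)) (vtx zero)

-- girth of G[S] is at least g (every cycle has length ≥ g; acyclic allowed)
GirthAtLeast : ∀ {n} → Graph n → (Fin n → Set) → ℕ → Set
GirthAtLeast G S g = ∀ k → Cycle G S k → g ≤ suc k

ComponentMinus : ∀ {n} → Graph n → Fin n → Fin n → Fin n → Set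
ComponentMinus G v r x = Reach G (Minus v) r x

data Coloured {n} (G : Graph n) (S : Subset n) : Fin n → Set where
  init  : ∀ {x} → x ∈ S → Coloured G S x
  force : ∀ {u x} → Coloured G S u → Adj G u x →
          (∀ w → Adj G u w → w ≢ x → Coloured G S w) → Coloured G S x

IsZeroForcingSet : ∀ {n} → Graph n → Subset n → Set
IsZeroForcingSet G S = ∀ x → Coloured G S x

IsZ : ∀ {n} → Graph n → ℕ → Set
IsZ G z = (∃ λ S → IsZeroForcingSet G S × ∣ S ∣ ≡ z) ×
          (∀ S → IsZeroForcingSet G S → z ≤ ∣ S ∣)

{-# OPTIONS --safe #-}

-- Isolate the cut vertex v, obtaining a graph H. After colouring v and at most
-- one further vertex (the one that v would have forced), a zero forcing set S
-- of G still forces all of H. Run the process in H until three distinct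
-- vertices of the component C of girth at least 5, and one vertex of another
-- component of G − v, have completely coloured closed neighbourhoods; this
-- costs at most four forces, so at most |S| + 6 vertices are then coloured.
-- Closed neighbourhoods in H have at least δ elements, and by the girth
-- condition the three in C have a union U with |U| ≥ 3δ − 4. The fourth
-- neighbourhood and v are disjoint from U, so
-- 3δ ≤ |U| + 4 ≤ |U| + δ + 1 ≤ |S| + 6.
module Submission where

open import Defs
open import Data.Bool using (true)
import Data.Bool as Bool
open import Data.Empty using (⊥; ⊥-elim)
open import Data.Fin using (Fin; zero; suc; _≟_)
open import Data.Fin.Properties using (any?; toℕ<n)
open import Data.Fin.Subset using (Subset; _∈_; _∉_; _⊆_; ∣_∣; _∪_; _∩_; ⁅_⁆; _⊃_; Empty; inside; outside)
open import Data.Fin.Subset.Induction using (⊃-wellFounded; Acc; acc)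
open import Data.Fin.Subset.Properties
open import Data.Nat using (ℕ; suc; _≤_; _+_; _*_; _∸_; z≤n; s≤s)
open import Data.Nat.Properties hiding (_≟_)
open import Data.Product using (Σ; ∃; _×_; _,_; proj₁; proj₂)
open import Data.Sum using (_⊎_; inj₁; inj₂; [_,_]′)
open import Data.Unit using (tt)
open import Data.Vec using ([]; _∷_; tabulate)
open import Data.Vec.Properties using ([]=⇒lookup; lookup⇒[]=; lookup∘tabulate)
open import Function using (_∘_; id)
open import Function.Bundles using (mk⇔)
open import Relation.Binary.PropositionalEquality using (_≡_; _≢_; refl; trans; cong; subst; ≢-sym) renaming (sym to ≡-sym)
open import Relation.Nullary using (¬_; Dec; yes; no; does; contradiction)
open import Relation.Nullary.Decidable using (_×-dec_; ¬?; decidable-stable; dec-true; dec-false; does-⇔)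

-- Cardinalities of subsets

∣p∪q∣+∣p∩q∣≡∣p∣+∣q∣ : ∀ {n} (p q : Subset n) → ∣ p ∪ q ∣ + ∣ p ∩ q ∣ ≡ ∣ p ∣ + ∣ q ∣
∣p∪q∣+∣p∩q∣≡∣p∣+∣q∣ []            []            = refl
∣p∪q∣+∣p∩q∣≡∣p∣+∣q∣ (outside ∷ p) (outside ∷ q) = ∣p∪q∣+∣p∩q∣≡∣p∣+∣q∣ p q
∣p∪q∣+∣p∩q∣≡∣p∣+∣q∣ (inside ∷ p)  (outside ∷ q) = cong suc (∣p∪q∣+∣p∩q∣≡∣p∣+∣q∣ p q)
∣p∪q∣+∣p∩q∣≡∣p∣+∣q∣ (outside ∷ p) (inside ∷ q)  =
  trans (cong suc (∣p∪q∣+∣p∩q∣≡∣p∣+∣q∣ p q)) (≡-sym (+-suc ∣ p ∣ ∣ q ∣))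
∣p∪q∣+∣p∩q∣≡∣p∣+∣q∣ (inside ∷ p)  (inside ∷ q)  =
  cong suc (trans (+-suc _ _)
    (trans (cong suc (∣p∪q∣+∣p∩q∣≡∣p∣+∣q∣ p q)) (≡-sym (+-suc ∣ p ∣ ∣ q ∣))))

∣p∪q∣≤∣p∣+∣q∣ : ∀ {n} (p q : Subset n) → ∣ p ∪ q ∣ ≤ ∣ p ∣ + ∣ q ∣
∣p∪q∣≤∣p∣+∣q∣ p q = ≤-trans (m≤m+n _ _) (≤-reflexive (∣p∪q∣+∣p∩q∣≡∣p∣+∣q∣ p q))

Empty⇒∣p∣≡0 : ∀ {n} {p : Subset n} → Empty p → ∣ p ∣ ≡ 0
Empty⇒∣p∣≡0 {n} e = trans (cong ∣_∣ (Empty-unique e)) (∣⊥∣≡0 n)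

disjoint⇒∣p∪q∣≡∣p∣+∣q∣ : ∀ {n} (p q : Subset n) → (∀ x → x ∈ p → x ∉ q) →
                         ∣ p ∪ q ∣ ≡ ∣ p ∣ + ∣ q ∣
disjoint⇒∣p∪q∣≡∣p∣+∣q∣ p q dis =
  trans (≡-sym (+-identityʳ _))
    (trans (cong (∣ p ∪ q ∣ +_) (≡-sym (Empty⇒∣p∣≡0 empty))) (∣p∪q∣+∣p∩q∣≡∣p∣+∣q∣ p q))
  where
  empty : Empty (p ∩ q)
  empty (x , x∈) = dis x (proj₁ (x∈p∩q⁻ p q x∈)) (proj₂ (x∈p∩q⁻ p q x∈))

∪-all : ∀ {n} (P : Fin n → Set) (p q : Subset n) → (∀ {x} → x ∈ p → P x) → (∀ {x} → x ∈ q → P x) →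
        ∀ {x} → x ∈ p ∪ q → P x
∪-all P p q allp allq x∈ = [ allp , allq ]′ (x∈p∪q⁻ p q x∈)

∣⁅x⁆∪p∣≤1+∣p∣ : ∀ {n} (x : Fin n) (p : Subset n) → ∣ ⁅ x ⁆ ∪ p ∣ ≤ 1 + ∣ p ∣
∣⁅x⁆∪p∣≤1+∣p∣ x p = subst (λ k → ∣ ⁅ x ⁆ ∪ p ∣ ≤ k + ∣ p ∣) (∣⁅x⁆∣≡1 x) (∣p∪q∣≤∣p∣+∣q∣ ⁅ x ⁆ p)

x∉p⇒∣⁅x⁆∪p∣≡1+∣p∣ : ∀ {n} (x : Fin n) (p : Subset n) → x ∉ p → ∣ ⁅ x ⁆ ∪ p ∣ ≡ 1 + ∣ p ∣
x∉p⇒∣⁅x⁆∪p∣≡1+∣p∣ x p x∉p =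
  trans (disjoint⇒∣p∪q∣≡∣p∣+∣q∣ ⁅ x ⁆ p λ y y∈ y∈p → x∉p (subst (_∈ p) (x∈⁅y⁆⇒x≡y x y∈) y∈p))
    (cong (_+ ∣ p ∣) (∣⁅x⁆∣≡1 x))

all-equal⇒∣p∣≤1 : ∀ {n} {p : Subset n} → (∀ {x y} → x ∈ p → y ∈ p → x ≡ y) → ∣ p ∣ ≤ 1
all-equal⇒∣p∣≤1 {p = p} eq with nonempty? p
... | no e = ≤-trans (≤-reflexive (Empty⇒∣p∣≡0 e)) z≤n
... | yes (x , x∈p) =
  ≤-trans (p⊆q⇒∣p∣≤∣q∣ λ y∈p → subst (_∈ ⁅ x ⁆) (eq x∈p y∈p) (x∈⁅x⁆ x)) (≤-reflexive (∣⁅x⁆∣≡1 x))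

contained-in-pair⇒∣p∣≤2 : ∀ {n} {p : Subset n} a b → (∀ {x} → x ∈ p → x ≡ a ⊎ x ≡ b) → ∣ p ∣ ≤ 2
contained-in-pair⇒∣p∣≤2 {p = p} a b p⊆ =
  ≤-trans (p⊆q⇒∣p∣≤∣q∣ p⊆ab)
    (≤-trans (∣⁅x⁆∪p∣≤1+∣p∣ a ⁅ b ⁆) (s≤s (≤-reflexive (∣⁅x⁆∣≡1 b))))
  where
  p⊆ab : p ⊆ ⁅ a ⁆ ∪ ⁅ b ⁆
  p⊆ab x∈p with p⊆ x∈p
  ... | inj₁ refl = x∈p∪q⁺ (inj₁ (x∈⁅x⁆ a))
  ... | inj₂ refl = x∈p∪q⁺ (inj₂ (x∈⁅x⁆ b))

element-avoiding-pair : ∀ {n} {p : Subset n} → 3 ≤ ∣ p ∣ → ∀ a b → ∃ λ x → x ∈ p × x ≢ a × x ≢ b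
element-avoiding-pair {p = p} 3≤ a b
  with any? (λ x → (x ∈? p) ×-dec (¬? (x ≟ a) ×-dec ¬? (x ≟ b)))
... | yes found = found
... | no none = contradiction 3≤ (<⇒≱ (s≤s (contained-in-pair⇒∣p∣≤2 a b p⊆ab)))
  where
  p⊆ab : ∀ {x} → x ∈ p → x ≡ a ⊎ x ≡ b
  p⊆ab {x} x∈p with x ≟ a | x ≟ b
  ... | yes x≡a | _       = inj₁ x≡a
  ... | no _    | yes x≡b = inj₂ x≡b
  ... | no x≢a  | no x≢b  = contradiction (x , x∈p , x≢a , x≢b) none

-- Inclusion-exclusion is applied twice, first to `p` and `q`, then to their union and `r`; each
-- application loses at most two elements.
almost-disjoint-union : ∀ {n k} (p q r : Subset n) → k ≤ ∣ p ∣ → k ≤ ∣ q ∣ → k ≤ ∣ r ∣ →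
  ∣ p ∩ q ∣ ≤ 2 → ∣ (p ∪ q) ∩ r ∣ ≤ 2 → 3 * k ≤ 4 + ∣ (p ∪ q) ∪ r ∣
almost-disjoint-union {k = k} p q r k≤p k≤q k≤r pq≤2 pqr≤2 = begin
  k + (k + (k + 0))               ≡⟨ cong (λ m → k + (k + m)) (+-identityʳ k) ⟩
  k + (k + k)                     ≡⟨ +-assoc k k k ⟨
  (k + k) + k                     ≤⟨ +-monoˡ-≤ k k+k≤ ⟩
  (2 + ∣ p ∪ q ∣) + k             ≤⟨ +-monoʳ-≤ (2 + ∣ p ∪ q ∣) k≤r ⟩
  2 + (∣ p ∪ q ∣ + ∣ r ∣)         ≤⟨ +-monoʳ-≤ 2 (∪-bound (p ∪ q) r pqr≤2) ⟩
  4 + ∣ (p ∪ q) ∪ r ∣             ∎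
  where
  open ≤-Reasoning
  ∪-bound : ∀ s t → ∣ s ∩ t ∣ ≤ 2 → ∣ s ∣ + ∣ t ∣ ≤ 2 + ∣ s ∪ t ∣
  ∪-bound s t st≤2 = begin
    ∣ s ∣ + ∣ t ∣          ≡⟨ ∣p∪q∣+∣p∩q∣≡∣p∣+∣q∣ s t ⟨
    ∣ s ∪ t ∣ + ∣ s ∩ t ∣  ≤⟨ +-monoʳ-≤ ∣ s ∪ t ∣ st≤2 ⟩
    ∣ s ∪ t ∣ + 2          ≡⟨ +-comm ∣ s ∪ t ∣ 2 ⟩
    2 + ∣ s ∪ t ∣          ∎
  k+k≤ : k + k ≤ 2 + ∣ p ∪ q ∣
  k+k≤ = ≤-trans (+-mono-≤ k≤p k≤q) (∪-bound p q pq≤2)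

-- Closed neighbourhoods

Adj? : ∀ {n} (G : Graph n) x y → Dec (Adj G x y)
Adj? G x y = adj G x y Bool.≟ true

Adj-sym : ∀ {n} (G : Graph n) {x y} → Adj G x y → Adj G y x
Adj-sym G {x} {y} x~y = trans (sym G y x) x~y

Adj⇒≢ : ∀ {n} (G : Graph n) {x y} → Adj G x y → x ≢ y
Adj⇒≢ G {x} x~x refl with trans (≡-sym x~x) (irrefl G x)
... | ()

N : ∀ {n} → Graph n → Fin n → Subset n
N G u = tabulate (adj G u)

N[] : ∀ {n} → Graph n → Fin n → Subset n
N[] G u = ⁅ u ⁆ ∪ N G u

module _ {n : ℕ} (G : Graph n) where

  ∈N⁺ : ∀ {u x} → Adj G u x → x ∈ N G u
  ∈N⁺ {u} {x} u~x = lookup⇒[]= x (N G u) (trans (lookup∘tabulate (adj G u) x) u~x)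

  ∈N⁻ : ∀ {u x} → x ∈ N G u → Adj G u x
  ∈N⁻ {u} {x} x∈ = trans (≡-sym (lookup∘tabulate (adj G u) x)) ([]=⇒lookup x∈)

  ∈N[]-centre : ∀ u → u ∈ N[] G u
  ∈N[]-centre u = x∈p∪q⁺ (inj₁ (x∈⁅x⁆ u))

  ∈N[]-adj : ∀ {u x} → Adj G u x → x ∈ N[] G u
  ∈N[]-adj u~x = x∈p∪q⁺ (inj₂ (∈N⁺ u~x))

  ∈N[]⁻ : ∀ {u x} → x ∈ N[] G u → x ≡ u ⊎ Adj G u x
  ∈N[]⁻ {u} x∈ with x∈p∪q⁻ ⁅ u ⁆ (N G u) x∈
  ... | inj₁ x∈u = inj₁ (x∈⁅y⁆⇒x≡y u x∈u)
  ... | inj₂ x∈N = inj₂ (∈N⁻ x∈N)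

  ∣N[]∣≡1+degree : ∀ u → ∣ N[] G u ∣ ≡ 1 + degree G u
  ∣N[]∣≡1+degree u = x∉p⇒∣⁅x⁆∪p∣≡1+∣p∣ u (N G u) λ u∈ → Adj⇒≢ G (∈N⁻ u∈) refl

-- Says that `P` is a union of connected components of `G`.
Closed : ∀ {n} → Graph n → (Fin n → Set) → Set
Closed G P = ∀ {x y} → P x → Adj G x y → P y

Closed-N[] : ∀ {n} (G : Graph n) {P : Fin n → Set} → Closed G P → ∀ {u x} → P u → x ∈ N[] G u → P x
Closed-N[] G closed Pu x∈ with ∈N[]⁻ G x∈
... | inj₁ refl = Pu
... | inj₂ u~x  = closed Pu u~x

-- Of at least three elements of the closed neighbourhood, `u` and `t` rule out at most two.
neighbour-avoiding : ∀ {n} (G : Graph n) {u} → 3 ≤ ∣ N[] G u ∣ → ∀ t → ∃ λ x → Adj G u x × x ≢ t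
neighbour-avoiding G {u} 3≤ t with element-avoiding-pair 3≤ u t
... | x , x∈ , x≢u , x≢t with ∈N[]⁻ G x∈
...   | inj₁ x≡u = contradiction x≡u x≢u
...   | inj₂ u~x = x , u~x , x≢t

-- Three closed neighbourhoods in girth at least five

-- Both hypotheses ask `P` of one vertex of the cycle only: for `P` closed under adjacency the other
-- vertices follow. In the square, only the two diagonal pairs need explicit distinctness.
module GirthFive {n : ℕ} (H : Graph n) (P : Fin n → Set)
  (no-triangle : ∀ {a b c} → P a → Adj H a b → Adj H b c → Adj H c a → ⊥)
  (no-square : ∀ {a b c d} → P a → Adj H a b → Adj H b c → Adj H c d → Adj H d a →
               a ≢ c → b ≢ d → ⊥)
  where

  common-neighbour : ∀ {a b x} → a ≢ b → ¬ Adj H a b → x ∈ N[] H a → x ∈ N[] H b →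
                     Adj H a x × Adj H x b
  common-neighbour a≢b a≁b x∈a x∈b with ∈N[]⁻ H x∈a | ∈N[]⁻ H x∈b
  ... | inj₁ refl | inj₁ refl = contradiction refl a≢b
  ... | inj₁ refl | inj₂ b~a  = contradiction (Adj-sym H b~a) a≁b
  ... | inj₂ a~b  | inj₁ refl = contradiction a~b a≁b
  ... | inj₂ a~x  | inj₂ b~x  = a~x , Adj-sym H b~x

  -- Two distinct common vertices `x` and `y` would make `a`, `x`, `b`, `y` a square.
  common-unique : ∀ {a b x y} → P a → a ≢ b → ¬ Adj H a b →
                  x ∈ N[] H a → x ∈ N[] H b → y ∈ N[] H a → y ∈ N[] H b → x ≡ y
  common-unique {x = x} {y} Pa a≢b a≁b xa xb ya yb with x ≟ y
  ... | yes x≡y = x≡y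
  ... | no x≢y with common-neighbour a≢b a≁b xa xb | common-neighbour a≢b a≁b ya yb
  ...   | a~x , x~b | a~y , y~b =
    ⊥-elim (no-square Pa a~x x~b (Adj-sym H y~b) (Adj-sym H a~y) a≢b x≢y)

  common-of-adjacent : ∀ {a b x} → P a → Adj H a b → x ∈ N[] H a → x ∈ N[] H b → x ≡ a ⊎ x ≡ b
  common-of-adjacent Pa a~b x∈a x∈b with ∈N[]⁻ H x∈a | ∈N[]⁻ H x∈b
  ... | inj₁ x≡a | _        = inj₁ x≡a
  ... | inj₂ _   | inj₁ x≡b = inj₂ x≡b
  ... | inj₂ a~x | inj₂ b~x = ⊥-elim (no-triangle Pa a~b b~x (Adj-sym H a~x))

  ∣∩∣≤1 : ∀ {a b} → P a → a ≢ b → ¬ Adj H a b → ∣ N[] H a ∩ N[] H b ∣ ≤ 1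
  ∣∩∣≤1 {a} {b} Pa a≢b a≁b = all-equal⇒∣p∣≤1 λ x∈ y∈ →
    let (xa , xb) = x∈p∩q⁻ (N[] H a) (N[] H b) x∈
        (ya , yb) = x∈p∩q⁻ (N[] H a) (N[] H b) y∈
    in common-unique Pa a≢b a≁b xa xb ya yb

  ∣∩∣≤2 : ∀ {a b} → P a → a ≢ b → ∣ N[] H a ∩ N[] H b ∣ ≤ 2
  ∣∩∣≤2 {a} {b} Pa a≢b with Adj? H a b
  ... | no a≁b  = ≤-trans (∣∩∣≤1 Pa a≢b a≁b) (s≤s z≤n)
  ... | yes a~b = contained-in-pair⇒∣p∣≤2 a b λ x∈ →
    let (xa , xb) = x∈p∩q⁻ (N[] H a) (N[] H b) x∈ in common-of-adjacent Pa a~b xa xb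

  module _ {k : ℕ} (large : ∀ {a} → P a → k ≤ ∣ N[] H a ∣) {U : Subset n} where

    private
      union-bound : ∀ {a b c} → P a → P b → P c → a ≢ b →
        ∣ (N[] H a ∪ N[] H b) ∩ N[] H c ∣ ≤ 2 →
        N[] H a ⊆ U → N[] H b ⊆ U → N[] H c ⊆ U → 3 * k ≤ 4 + ∣ U ∣
      union-bound {a} {b} {c} Pa Pb Pc a≢b abc≤2 a⊆ b⊆ c⊆ =
        ≤-trans
          (almost-disjoint-union (N[] H a) (N[] H b) (N[] H c)
            (large Pa) (large Pb) (large Pc) (∣∩∣≤2 Pa a≢b) abc≤2)
          (+-monoʳ-≤ 4 (p⊆q⇒∣p∣≤∣q∣
            (∪-all (_∈ U) (N[] H a ∪ N[] H b) (N[] H c) (∪-all (_∈ U) (N[] H a) (N[] H b) a⊆ b⊆) c⊆)))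

      -- Since there is no triangle, `a` and `c` are not adjacent, so `N[] H a` meets `N[] H c` in
      -- `b` alone; `N[] H b` meets it within the pair `b`, `c`.
      path-bound : ∀ {a b c} → P a → P b → P c → a ≢ c → Adj H a b → Adj H b c →
        N[] H a ⊆ U → N[] H b ⊆ U → N[] H c ⊆ U → 3 * k ≤ 4 + ∣ U ∣
      path-bound {a} {b} {c} Pa Pb Pc a≢c a~b b~c =
        union-bound Pa Pb Pc (Adj⇒≢ H a~b) (contained-in-pair⇒∣p∣≤2 b c common)
        where
        common : ∀ {x} → x ∈ (N[] H a ∪ N[] H b) ∩ N[] H c → x ≡ b ⊎ x ≡ c
        common x∈ with x∈p∩q⁻ (N[] H a ∪ N[] H b) (N[] H c) x∈
        ... | x∈ab , x∈c with x∈p∪q⁻ (N[] H a) (N[] H b) x∈ab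
        ...   | inj₁ x∈a = inj₁ (common-unique Pa a≢c
                  (λ a~c → no-triangle Pa a~b b~c (Adj-sym H a~c))
                  x∈a x∈c (∈N[]-adj H a~b) (∈N[]-adj H (Adj-sym H b~c)))
        ...   | inj₂ x∈b = common-of-adjacent Pb b~c x∈b x∈c

      -- Each of `N[] H a` and `N[] H b` shares at most one vertex with `N[] H c`, which gives two
      -- in total.
      isolated-bound : ∀ {a b c} → P a → P b → P c → a ≢ b → a ≢ c → b ≢ c →
        ¬ Adj H a c → ¬ Adj H b c →
        N[] H a ⊆ U → N[] H b ⊆ U → N[] H c ⊆ U → 3 * k ≤ 4 + ∣ U ∣
      isolated-bound {a} {b} {c} Pa Pb Pc a≢b a≢c b≢c a≁c b≁c =
        union-bound Pa Pb Pc a≢b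
          (subst (λ s → ∣ s ∣ ≤ 2) (≡-sym (∩-distribʳ-∪ (N[] H c) (N[] H a) (N[] H b)))
            (≤-trans (∣p∪q∣≤∣p∣+∣q∣ (N[] H a ∩ N[] H c) (N[] H b ∩ N[] H c))
              (+-mono-≤ (∣∩∣≤1 Pa a≢c a≁c) (∣∩∣≤1 Pb b≢c b≁c))))

    -- Inclusion–exclusion is applied with an endpoint of the path on a, b, c
    -- (or a vertex not adjacent to the other two) last, so that both
    -- intersections have at most two elements.
    three-neighbourhoods : ∀ {a b c} → P a → P b → P c → a ≢ b → a ≢ c → b ≢ c →
      N[] H a ⊆ U → N[] H b ⊆ U → N[] H c ⊆ U → 3 * k ≤ 4 + ∣ U ∣
    three-neighbourhoods {a} {b} {c} Pa Pb Pc a≢b a≢c b≢c a⊆ b⊆ c⊆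
      with Adj? H a b | Adj? H b c | Adj? H a c
    ... | yes a~b | yes b~c | _       = path-bound Pa Pb Pc a≢c a~b b~c a⊆ b⊆ c⊆
    ... | yes a~b | no _    | yes a~c = path-bound Pb Pa Pc b≢c (Adj-sym H a~b) a~c b⊆ a⊆ c⊆
    ... | no _    | yes b~c | yes a~c = path-bound Pa Pc Pb a≢b a~c (Adj-sym H b~c) a⊆ c⊆ b⊆
    ... | _       | no b≁c  | no a≁c  = isolated-bound Pa Pb Pc a≢b a≢c b≢c a≁c b≁c a⊆ b⊆ c⊆
    ... | no a≁b  | yes _   | no a≁c  =
      isolated-bound Pb Pc Pa b≢c (≢-sym a≢b) (≢-sym a≢c)
        (a≁b ∘ Adj-sym H) (a≁c ∘ Adj-sym H) b⊆ c⊆ a⊆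
    ... | no a≁b  | no b≁c  | yes _   =
      isolated-bound Pa Pc Pb a≢c a≢b (≢-sym b≢c) a≁b (b≁c ∘ Adj-sym H) a⊆ c⊆ b⊆

-- The forcing process

record Force {n} (G : Graph n) (B : Subset n) : Set where
  field
    source target : Fin n
    source∈       : source ∈ B
    target∉       : target ∉ B
    adjacent      : Adj G source target
    others∈       : ∀ y → Adj G source y → y ≢ target → y ∈ B

Coloured-mono : ∀ {n} {G : Graph n} {S T : Subset n} → S ⊆ T → ∀ {x} → Coloured G S x → Coloured G T x
Coloured-mono S⊆T (init x∈)         = init (S⊆T x∈)
Coloured-mono S⊆T (force cu u~x cs) =
  force (Coloured-mono S⊆T cu) u~x λ w u~w w≢x → Coloured-mono S⊆T (cs w u~w w≢x)

-- Follow the derivation of `x` backwards. While the forcing vertex, or one of its neighbours other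
-- than the target, lies outside `B`, move to that vertex and its smaller derivation. Initial
-- vertices lie in `B`, so the search stops at a force that is possible from `B`. Every move goes
-- along edges, hence stays in `P`.
find-force : ∀ {n} (G : Graph n) {S B : Subset n} {P : Fin n → Set} → Closed G P → S ⊆ B →
             ∀ {x} → P x → Coloured G S x → x ∉ B → Σ (Force G B) (P ∘ Force.source)
find-force G closed S⊆B Px (init x∈S) x∉B = contradiction (S⊆B x∈S) x∉B
find-force G {B = B} closed S⊆B {x} Px (force {u} cu u~x cs) x∉B
  with closed Px (Adj-sym G u~x) | u ∈? B
... | Pu | no u∉B = find-force G closed S⊆B Pu cu u∉B
... | Pu | yes u∈B
  with any? (λ w → Adj? G u w ×-dec (¬? (w ≟ x) ×-dec ¬? (w ∈? B)))
...   | yes (w , u~w , w≢x , w∉B) = find-force G closed S⊆B (closed Pu u~w) (cs w u~w w≢x) w∉B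
...   | no none = record
        { source = u ; target = x ; source∈ = u∈B ; target∉ = x∉B ; adjacent = u~x
        ; others∈ = λ y u~y y≢x →
            decidable-stable (y ∈? B) λ y∉B → none (y , u~y , y≢x , y∉B)
        } , Pu

-- Records how one more closed neighbourhood is filled at the cost of at most one vertex. The vertex
-- `a` is the preferred centre; `fresh` keeps any other centre distinct from those whose
-- neighbourhoods were full before.
record Extension {n} (G : Graph n) (P : Fin n → Set) (B : Subset n) (a : Fin n) : Set where
  field
    {centre}   : Fin n
    {extended} : Subset n
    centre∈P   : P centre
    ⊆extended  : B ⊆ extended
    cheap      : ∣ extended ∣ ≤ 1 + ∣ B ∣
    N[]⊆       : N[] G centre ⊆ extended
    fresh      : centre ≡ a ⊎ ¬ (N[] G centre ⊆ B)

  centre≢ : ∀ {u} → N[] G u ⊆ B → a ≢ u → centre ≢ u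
  centre≢ {u} u⊆B a≢u c≡u with fresh
  ... | inj₁ c≡a = a≢u (trans (≡-sym c≡a) c≡u)
  ... | inj₂ ¬⊆  = ¬⊆ (λ {x} → subst (λ t → N[] G t ⊆ B) (≡-sym c≡u) (λ {y} → u⊆B {y}) {x})

open Extension

-- If `N[] G a` is already full, `a` is the centre and nothing is added. Otherwise a vertex of it is
-- uncoloured, which yields a force inside `P`; adding its target fills the neighbourhood of its
-- source, and this was not full before because the target was missing.
extend : ∀ {n} (G : Graph n) {S B : Subset n} {P : Fin n → Set} → IsZeroForcingSet G S →
         Closed G P → S ⊆ B → ∀ {a} → P a → Extension G P B a
extend G {B = B} zf closed S⊆B {a} Pa with any? (λ x → (x ∈? N[] G a) ×-dec ¬? (x ∈? B))
... | no none = record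
  { centre∈P = Pa ; ⊆extended = id ; cheap = n≤1+n _
  ; N[]⊆ = λ {x} x∈ → decidable-stable (x ∈? B) λ x∉B → none (x , x∈ , x∉B)
  ; fresh = inj₁ refl }
... | yes (x , x∈ , x∉B) with find-force G closed S⊆B (Closed-N[] G closed Pa x∈) (zf x) x∉B
...   | f , Pu = record
  { centre∈P = Pu ; ⊆extended = x∈p∪q⁺ ∘ inj₂ ; cheap = ∣⁅x⁆∪p∣≤1+∣p∣ target B
  ; N[]⊆ = covered ; fresh = inj₂ λ ⊆B → target∉ (⊆B (∈N[]-adj G adjacent)) }
  where
  open Force f
  covered : N[] G source ⊆ ⁅ target ⁆ ∪ B
  covered {y} y∈ with ∈N[]⁻ G y∈ | y ≟ target
  ... | _         | yes refl = x∈p∪q⁺ (inj₁ (x∈⁅x⁆ y))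
  ... | inj₁ refl | no _     = x∈p∪q⁺ (inj₂ source∈)
  ... | inj₂ u~y  | no y≢    = x∈p∪q⁺ (inj₂ (others∈ y u~y y≢))

-- Isolating a vertex

does-true⁻ : ∀ {A : Set} (a? : Dec A) → does a? ≡ true → A
does-true⁻ (yes a) _ = a

module _ {n : ℕ} (G : Graph n) (v : Fin n) where

  isolated-adj? : ∀ x y → Dec (Adj G x y × x ≢ v × y ≢ v)
  isolated-adj? x y = Adj? G x y ×-dec (¬? (x ≟ v) ×-dec ¬? (y ≟ v))

  -- The vertex `v` stays as an isolated vertex instead of being deleted, so that `Fin n` and its
  -- subsets are unchanged.
  isolate : Graph n
  isolate = record
    { adj    = λ x y → does (isolated-adj? x y)
    ; sym    = λ x y → does-⇔
        (mk⇔ (λ (x~y , x≢ , y≢) → Adj-sym G x~y , y≢ , x≢)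
             (λ (y~x , y≢ , x≢) → Adj-sym G y~x , x≢ , y≢))
        (isolated-adj? x y) (isolated-adj? y x)
    ; irrefl = λ x → dec-false (isolated-adj? x x) λ (x~x , _) → Adj⇒≢ G x~x refl
    }

  isolate⁻ : ∀ {x y} → Adj isolate x y → Adj G x y × x ≢ v × y ≢ v
  isolate⁻ {x} {y} = does-true⁻ (isolated-adj? x y)

  isolate⁺ : ∀ {x y} → Adj G x y → x ≢ v → y ≢ v → Adj isolate x y
  isolate⁺ {x} {y} x~y x≢v y≢v = dec-true (isolated-adj? x y) (x~y , x≢v , y≢v)

  -- At most the neighbour `v` is lost, and `u` itself makes up for it in the closed neighbourhood.
  degree≤∣N[]-isolate∣ : ∀ {u} → u ≢ v → degree G u ≤ ∣ N[] isolate u ∣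
  degree≤∣N[]-isolate∣ {u} u≢v = begin
    ∣ N G u ∣               ≤⟨ p⊆q⇒∣p∣≤∣q∣ covered ⟩
    ∣ ⁅ v ⁆ ∪ N isolate u ∣ ≤⟨ ∣⁅x⁆∪p∣≤1+∣p∣ v (N isolate u) ⟩
    1 + ∣ N isolate u ∣     ≡⟨ ∣N[]∣≡1+degree isolate u ⟨
    ∣ N[] isolate u ∣       ∎
    where
    open ≤-Reasoning
    covered : N G u ⊆ ⁅ v ⁆ ∪ N isolate u
    covered {x} x∈ with x ≟ v
    ... | yes refl = x∈p∪q⁺ (inj₁ (x∈⁅x⁆ v))
    ... | no x≢v   = x∈p∪q⁺ (inj₂ (∈N⁺ isolate (isolate⁺ (∈N⁻ G x∈) u≢v x≢v)))

  -- B is what the forces not made by v have produced so far. As soon as v can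
  -- make a force v → x out of B, all neighbours of v lie in B ∪ {x}, so v is
  -- not needed as a forcer once x is coloured.
  private
    zero-forcing-isolate′ : ∀ {S : Subset n} → IsZeroForcingSet G S → ∀ B → Acc _⊃_ B →
      ⁅ v ⁆ ∪ S ⊆ B → (∀ {x} → x ∈ B → Coloured isolate (⁅ v ⁆ ∪ S) x) →
      ∃ λ x → IsZeroForcingSet isolate (⁅ x ⁆ ∪ (⁅ v ⁆ ∪ S))
    zero-forcing-isolate′ {S} zf B (acc rec) S⊆B B-col with any? (λ x → ¬? (x ∈? B))
    -- Everything was coloured without a force by `v`; the already coloured `v` stands in for the
    -- extra vertex.
    ... | no none = v , λ x → Coloured-mono (x∈p∪q⁺ ∘ inj₂)
      (B-col (decidable-stable (x ∈? B) λ x∉B → none (x , x∉B)))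
    ... | yes (x , x∉B)
      with find-force G {P = AllV} (λ _ _ → tt) (λ s → S⊆B (x∈p∪q⁺ (inj₂ s))) tt (zf x) x∉B
    ...   | f , _ with Force.source f ≟ v
    ...     | no u≢v = zero-forcing-isolate′ zf (⁅ target ⁆ ∪ B)
                (rec (x∈p∪q⁺ ∘ inj₂ , target , x∈p∪q⁺ (inj₁ (x∈⁅x⁆ target)) , target∉))
                (x∈p∪q⁺ ∘ inj₂ ∘ S⊆B) B+-col
      where
      open Force f
      target≢v : target ≢ v
      target≢v refl = target∉ (S⊆B (x∈p∪q⁺ (inj₁ (x∈⁅x⁆ v))))
      B+-col : ∀ {y} → y ∈ ⁅ target ⁆ ∪ B → Coloured isolate (⁅ v ⁆ ∪ S) y
      B+-col y∈ with x∈p∪q⁻ ⁅ target ⁆ B y∈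
      ... | inj₂ y∈B = B-col y∈B
      ... | inj₁ y∈t rewrite x∈⁅y⁆⇒x≡y target y∈t =
        force (B-col source∈) (isolate⁺ adjacent u≢v target≢v)
          λ w u~w w≢t → B-col (others∈ w (proj₁ (isolate⁻ u~w)) w≢t)
    ...     | yes refl = target , λ y → recolour (zf y)
      where
      open Force f
      T : Subset n
      T = ⁅ target ⁆ ∪ (⁅ v ⁆ ∪ S)
      recolour : ∀ {y} → Coloured G S y → Coloured isolate T y
      recolour (init y∈S) = init (x∈p∪q⁺ (inj₂ (x∈p∪q⁺ (inj₂ y∈S))))
      recolour {y} (force {u} cu u~y cs) with u ≟ v | y ≟ v | y ≟ target
      ... | _        | yes refl | _        = init (x∈p∪q⁺ (inj₂ (x∈p∪q⁺ (inj₁ (x∈⁅x⁆ v)))))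
      ... | _        | _        | yes refl = init (x∈p∪q⁺ (inj₁ (x∈⁅x⁆ target)))
      ... | yes refl | no _     | no y≢t   =
        Coloured-mono (x∈p∪q⁺ ∘ inj₂) (B-col (others∈ y u~y y≢t))
      -- Neighbours in `isolate` are neighbours in `G`, so this force has no additional conditions
      -- to meet.
      ... | no u≢v   | no y≢v   | no _     =
        force (recolour cu) (isolate⁺ u~y u≢v y≢v)
          λ w u~w w≢y → recolour (cs w (proj₁ (isolate⁻ u~w)) w≢y)

  zero-forcing-isolate : ∀ {S : Subset n} → IsZeroForcingSet G S →
    ∃ λ x → IsZeroForcingSet isolate (⁅ x ⁆ ∪ (⁅ v ⁆ ∪ S))
  zero-forcing-isolate {S} zf = zero-forcing-isolate′ zf (⁅ v ⁆ ∪ S) (⊃-wellFounded _) id init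

-- Components

module _ {n : ℕ} {G : Graph n} {S : Fin n → Set} where

  Reach-end : ∀ {x y} → Reach G S x y → S y
  Reach-end (here Sx)    = Sx
  Reach-end (step _ _ p) = Reach-end p

  Reach-trans : ∀ {x y z} → Reach G S x y → Reach G S y z → Reach G S x z
  Reach-trans (here _)        q = q
  Reach-trans (step Sx x~y p) q = step Sx x~y (Reach-trans p q)

  Reach-snoc : ∀ {x y z} → Reach G S x y → Adj G y z → S z → Reach G S x z
  Reach-snoc p y~z Sz = Reach-trans p (step (Reach-end p) y~z (here Sz))

  Reach-sym : ∀ {x y} → Reach G S x y → Reach G S y x
  Reach-sym (here Sx)        = here Sx
  Reach-sym (step Sx x~y p) = Reach-snoc (Reach-sym p) (Adj-sym G x~y) Sx

another : ∀ {b} → 2 ≤ b → (i : Fin b) → ∃ λ j → i ≢ j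
another (s≤s (s≤s _)) zero    = suc zero , λ ()
another (s≤s (s≤s _)) (suc i) = zero , λ ()

cut-vertex-separates : ∀ {n} {G : Graph n} {v r} → IsCutVertex G v → r ≢ v →
  ∃ λ s → s ≢ v × ¬ Reach G (Minus v) r s
cut-vertex-separates {v = v} {r} (a , b , (_ , _ , _ , cover) , (rep , rep≢v , separate , cover′) , a<b) r≢v
  with cover′ r r≢v
-- The component of `v` in `G` shows `1 ≤ a`, whence `2 ≤ b`.
... | i , i↝r with another (≤-trans (s≤s (≤-trans (s≤s z≤n) (toℕ<n (proj₁ (cover v tt))))) a<b) i
...   | j , i≢j = rep j , rep≢v j , λ r↝j → i≢j (separate i j (Reach-trans i↝r r↝j))

-- Excluding triangles and squares by girth

module _ {n : ℕ} {G : Graph n} {S : Fin n → Set} (girth : GirthAtLeast G S 5) where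

  girth5⇒no-triangle : ∀ {a b c} → S a → S b → S c → Adj G a b → Adj G b c → Adj G c a → ⊥
  -- The index of `Cycle` is one less than the length, so 2 stands for a triangle.
  girth5⇒no-triangle {a} {b} {c} Sa Sb Sc a~b b~c c~a with girth 2 cycle
    where
    vtx : Fin 3 → Fin n
    vtx zero             = a
    vtx (suc zero)       = b
    vtx (suc (suc zero)) = c
    inj : ∀ {i j} → vtx i ≡ vtx j → i ≡ j
    inj {zero}           {zero}           _ = refl
    inj {zero}           {suc zero}       e = contradiction e (Adj⇒≢ G a~b)
    inj {zero}           {suc (suc zero)} e = contradiction (≡-sym e) (Adj⇒≢ G c~a)
    inj {suc zero}       {zero}           e = contradiction (≡-sym e) (Adj⇒≢ G a~b)
    inj {suc zero}       {suc zero}       _ = refl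
    inj {suc zero}       {suc (suc zero)} e = contradiction e (Adj⇒≢ G b~c)
    inj {suc (suc zero)} {zero}           e = contradiction e (Adj⇒≢ G c~a)
    inj {suc (suc zero)} {suc zero}       e = contradiction (≡-sym e) (Adj⇒≢ G b~c)
    inj {suc (suc zero)} {suc (suc zero)} _ = refl
    cycle : Cycle G S 2
    cycle = record
      { len≥3 = ≤-refl ; vtx = vtx ; inj = inj
      ; inS   = λ { zero → Sa ; (suc zero) → Sb ; (suc (suc zero)) → Sc }
      ; edge  = λ { zero → a~b ; (suc zero) → b~c }
      ; close = c~a }
  ... | s≤s (s≤s (s≤s ()))

  girth5⇒no-square : ∀ {a b c d} → S a → S b → S c → S d →
    Adj G a b → Adj G b c → Adj G c d → Adj G d a → a ≢ c → b ≢ d → ⊥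
  girth5⇒no-square {a} {b} {c} {d} Sa Sb Sc Sd a~b b~c c~d d~a a≢c b≢d with girth 3 cycle
    where
    vtx : Fin 4 → Fin n
    vtx zero                   = a
    vtx (suc zero)             = b
    vtx (suc (suc zero))       = c
    vtx (suc (suc (suc zero))) = d
    inj : ∀ {i j} → vtx i ≡ vtx j → i ≡ j
    inj {zero}                 {zero}                 _ = refl
    inj {zero}                 {suc zero}             e = contradiction e (Adj⇒≢ G a~b)
    inj {zero}                 {suc (suc zero)}       e = contradiction e a≢c
    inj {zero}                 {suc (suc (suc zero))} e = contradiction (≡-sym e) (Adj⇒≢ G d~a)
    inj {suc zero}             {zero}                 e = contradiction (≡-sym e) (Adj⇒≢ G a~b)
    inj {suc zero}             {suc zero}             _ = refl
    inj {suc zero}             {suc (suc zero)}       e = contradiction e (Adj⇒≢ G b~c)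
    inj {suc zero}             {suc (suc (suc zero))} e = contradiction e b≢d
    inj {suc (suc zero)}       {zero}                 e = contradiction (≡-sym e) a≢c
    inj {suc (suc zero)}       {suc zero}             e = contradiction (≡-sym e) (Adj⇒≢ G b~c)
    inj {suc (suc zero)}       {suc (suc zero)}       _ = refl
    inj {suc (suc zero)}       {suc (suc (suc zero))} e = contradiction e (Adj⇒≢ G c~d)
    inj {suc (suc (suc zero))} {zero}                 e = contradiction e (Adj⇒≢ G d~a)
    inj {suc (suc (suc zero))} {suc zero}             e = contradiction (≡-sym e) b≢d
    inj {suc (suc (suc zero))} {suc (suc zero)}       e = contradiction (≡-sym e) (Adj⇒≢ G c~d)
    inj {suc (suc (suc zero))} {suc (suc (suc zero))} _ = refl
    cycle : Cycle G S 3
    cycle = record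
      { len≥3 = n≤1+n 3 ; vtx = vtx ; inj = inj
      ; inS   = λ { zero → Sa ; (suc zero) → Sb ; (suc (suc zero)) → Sc ; (suc (suc (suc zero))) → Sd }
      ; edge  = λ { zero → a~b ; (suc zero) → b~c ; (suc (suc zero)) → c~d }
      ; close = d~a }
  ... | s≤s (s≤s (s≤s (s≤s ())))

-- Counting the coloured vertices in two components

theorem5 : ∀ (n : ℕ) (G : Graph n) (δ : ℕ) (v : Fin n) (z : ℕ) →
    IsMinDegree G δ → 3 ≤ δ →
    IsCutVertex G v →
    Σ (Fin n) (λ r → r ≢ v × GirthAtLeast G (ComponentMinus G v r) 5) →
    IsZ G z →
    3 * δ ∸ 6 ≤ z
theorem5 n G δ v z (δ≤degree , _) 3≤δ cut (r , r≢v , girth) ((S , S-zf , refl) , _)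
  with cut-vertex-separates cut r≢v | zero-forcing-isolate G v S-zf
... | s , s≢v , r↛s | x , T-zf = m≤n+o⇒m∸n≤o (3 * δ) 6 (begin
  3 * δ                           ≤⟨ GirthFive.three-neighbourhoods H C no-triangle no-square large
                                       (centre∈P e₁) (centre∈P e₂) (centre∈P e₃)
                                       (≢-sym u₂≢u₁) (≢-sym u₃≢u₁) (≢-sym u₃≢u₂)
                                       N₁⊆U N₂⊆U N₃⊆U ⟩
  -- The deficit of 4 is split: three units are paid by `W`, which has at least `δ` elements, and
  -- one by `v`.
  4 + ∣ U ∣                       ≡⟨ cong suc (+-comm 3 ∣ U ∣) ⟩
  1 + (∣ U ∣ + 3)                 ≤⟨ s≤s (+-monoʳ-≤ ∣ U ∣ (≤-trans 3≤δ (large (centre∈P e₄)))) ⟩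
  1 + (∣ U ∣ + ∣ W ∣)             ≡⟨ cong suc (disjoint⇒∣p∪q∣≡∣p∣+∣q∣ U W U∩W) ⟨
  1 + ∣ U ∪ W ∣                   ≡⟨ x∉p⇒∣⁅x⁆∪p∣≡1+∣p∣ v (U ∪ W) v∉ ⟨
  ∣ ⁅ v ⁆ ∪ (U ∪ W) ∣             ≤⟨ p⊆q⇒∣p∣≤∣q∣ all⊆ ⟩
  -- From here the 6 builds up: one vertex for each of the four extensions, then `x` and `v`.
  ∣ extended e₄ ∣                 ≤⟨ cheap e₄ ⟩
  1 + ∣ extended e₃ ∣             ≤⟨ +-monoʳ-≤ 1 (cheap e₃) ⟩
  2 + ∣ extended e₂ ∣             ≤⟨ +-monoʳ-≤ 2 (cheap e₂) ⟩
  3 + ∣ extended e₁ ∣             ≤⟨ +-monoʳ-≤ 3 (cheap e₁) ⟩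
  4 + ∣ T ∣                       ≤⟨ +-monoʳ-≤ 4 (∣⁅x⁆∪p∣≤1+∣p∣ x (⁅ v ⁆ ∪ S)) ⟩
  5 + ∣ ⁅ v ⁆ ∪ S ∣               ≤⟨ +-monoʳ-≤ 5 (∣⁅x⁆∪p∣≤1+∣p∣ v S) ⟩
  6 + ∣ S ∣                       ∎)
  where
  open ≤-Reasoning
  H : Graph n
  H = isolate G v
  C D : Fin n → Set
  C = ComponentMinus G v r
  D = ComponentMinus G v s
  T : Subset n
  T = ⁅ x ⁆ ∪ (⁅ v ⁆ ∪ S)

  -- Edges of `H` avoid `v`, so they never leave a component of G - v.
  closed : ∀ {t} → Closed H (ComponentMinus G v t)
  closed p y~z with isolate⁻ G v y~z
  ... | y~z′ , _ , z≢v = Reach-snoc p y~z′ z≢v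

  in-G : ∀ {a b} → Adj H a b → Adj G a b
  in-G = proj₁ ∘ isolate⁻ G v

  large : ∀ {t u} → ComponentMinus G v t u → δ ≤ ∣ N[] H u ∣
  large {u = u} p = ≤-trans (δ≤degree u) (degree≤∣N[]-isolate∣ G v (Reach-end p))

  no-triangle : ∀ {a b c} → C a → Adj H a b → Adj H b c → Adj H c a → ⊥
  no-triangle Ca a~b b~c c~a =
    girth5⇒no-triangle girth Ca (closed Ca a~b) (closed (closed Ca a~b) b~c)
      (in-G a~b) (in-G b~c) (in-G c~a)

  no-square : ∀ {a b c d} → C a → Adj H a b → Adj H b c → Adj H c d → Adj H d a →
              a ≢ c → b ≢ d → ⊥
  no-square Ca a~b b~c c~d d~a =
    girth5⇒no-square girth Ca (closed Ca a~b) (closed (closed Ca a~b) b~c)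
      (closed Ca (Adj-sym H d~a)) (in-G a~b) (in-G b~c) (in-G c~d) (in-G d~a)

  e₁ : Extension H C T r
  e₁ = extend H T-zf closed id (here r≢v)
  u₁ : Fin n
  u₁ = centre e₁

  -- Only `u₁` has to be avoided so far, so it also fills the slot of the excluded vertex.
  second : ∃ λ a → Adj H u₁ a × a ≢ u₁
  second = neighbour-avoiding H (≤-trans 3≤δ (large (centre∈P e₁))) u₁
  e₂ : Extension H C (extended e₁) (proj₁ second)
  e₂ = extend H T-zf closed (⊆extended e₁) (closed (centre∈P e₁) (proj₁ (proj₂ second)))
  u₂ : Fin n
  u₂ = centre e₂
  u₂≢u₁ : u₂ ≢ u₁
  u₂≢u₁ = centre≢ e₂ (N[]⊆ e₁) (proj₂ (proj₂ second))

  -- The candidate is again a neighbour of `u₁`: adjacency separates it from `u₁`, which leaves the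
  -- excluded vertex free to be `u₂`.
  third : ∃ λ a → Adj H u₁ a × a ≢ u₂
  third = neighbour-avoiding H (≤-trans 3≤δ (large (centre∈P e₁))) u₂
  e₃ : Extension H C (extended e₂) (proj₁ third)
  e₃ = extend H T-zf closed (⊆extended e₂ ∘ ⊆extended e₁)
         (closed (centre∈P e₁) (proj₁ (proj₂ third)))
  u₃ : Fin n
  u₃ = centre e₃
  u₃≢u₁ : u₃ ≢ u₁
  u₃≢u₁ = centre≢ e₃ (⊆extended e₂ ∘ N[]⊆ e₁) (≢-sym (Adj⇒≢ H (proj₁ (proj₂ third))))
  u₃≢u₂ : u₃ ≢ u₂
  u₃≢u₂ = centre≢ e₃ (N[]⊆ e₂) (proj₂ (proj₂ third))

  -- The search for a force is confined to `D`, so the new centre and its closed neighbourhood lie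
  -- in the component of `s`.
  e₄ : Extension H D (extended e₃) s
  e₄ = extend H T-zf closed (⊆extended e₃ ∘ ⊆extended e₂ ∘ ⊆extended e₁) (here s≢v)

  U W : Subset n
  U = N[] H u₁ ∪ (N[] H u₂ ∪ N[] H u₃)
  W = N[] H (centre e₄)

  N₁⊆U : N[] H u₁ ⊆ U
  N₁⊆U = p⊆p∪q (N[] H u₂ ∪ N[] H u₃)
  N₂⊆U : N[] H u₂ ⊆ U
  N₂⊆U = q⊆p∪q (N[] H u₁) (N[] H u₂ ∪ N[] H u₃) ∘ p⊆p∪q (N[] H u₃)
  N₃⊆U : N[] H u₃ ⊆ U
  N₃⊆U = q⊆p∪q (N[] H u₁) (N[] H u₂ ∪ N[] H u₃) ∘ q⊆p∪q (N[] H u₂) (N[] H u₃)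

  U-all : (P : Fin n → Set) → (∀ {y} → y ∈ N[] H u₁ → P y) → (∀ {y} → y ∈ N[] H u₂ → P y) →
          (∀ {y} → y ∈ N[] H u₃ → P y) → ∀ {y} → y ∈ U → P y
  U-all P all₁ all₂ all₃ =
    ∪-all P (N[] H u₁) (N[] H u₂ ∪ N[] H u₃) all₁ (∪-all P (N[] H u₂) (N[] H u₃) all₂ all₃)

  U⊆C : ∀ {y} → y ∈ U → C y
  U⊆C = U-all C (Closed-N[] H closed (centre∈P e₁)) (Closed-N[] H closed (centre∈P e₂))
              (Closed-N[] H closed (centre∈P e₃))

  W⊆D : ∀ {y} → y ∈ W → D y
  W⊆D = Closed-N[] H closed (centre∈P e₄)

  -- A common vertex would connect `r` to `s` in G - v.
  U∩W : ∀ y → y ∈ U → y ∉ W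
  U∩W y y∈U y∈W = r↛s (Reach-trans {y = y} (U⊆C {y} y∈U) (Reach-sym (W⊆D {y} y∈W)))

  v∉ : v ∉ U ∪ W
  v∉ v∈ = ∪-all (_≢ v) U W (Reach-end ∘ U⊆C) (Reach-end ∘ W⊆D) v∈ refl

  v∈T : v ∈ T
  v∈T = x∈p∪q⁺ (inj₂ (x∈p∪q⁺ (inj₁ (x∈⁅x⁆ v))))

  all⊆ : ⁅ v ⁆ ∪ (U ∪ W) ⊆ extended e₄
  all⊆ = ∪-all (_∈ extended e₄) ⁅ v ⁆ (U ∪ W)
    (λ y∈ → subst (_∈ extended e₄) (≡-sym (x∈⁅y⁆⇒x≡y v y∈))
      (⊆extended e₄ (⊆extended e₃ (⊆extended e₂ (⊆extended e₁ v∈T)))))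
    (∪-all (_∈ extended e₄) U W
      (⊆extended e₄ ∘ U-all (_∈ extended e₃)
        (⊆extended e₃ ∘ ⊆extended e₂ ∘ N[]⊆ e₁) (⊆extended e₃ ∘ N[]⊆ e₂) (N[]⊆ e₃))
      (N[]⊆ e₄))
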